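{- Let $G_1,\dots,G_{42}$ be the complete list of $4$-vertex oriented graphs up to isomorphism, $c_i=t(G_i)+i(G_i)$, and let $\mathcal F=\mathcal F_\emptyset\cup\mathcal F_{\bar E}\cup\mathcal F_E$ (20 flags in total, in a fixed order). Then there exists a $20\times20$ positive semidefinite matrix $Q$ such that $c_i\ge\langle Q,A_{G_i}\rangle+\frac19$ for every $1\le i\le 42$ (a $\frac19$-certificate for the SDP: minimize $\sum_i p_ic_i$ subject to $p_i\ge0$, $\sum_ip_i=1$, $\sum_i p_iA_{G_i}\succeq0$).
   Context: An oriented graph is a directed graph with no loops and no multiple (parallel or anti-parallel) edges; $t(G)$ (resp. $i(G)$) is the probability that a uniformly random $3$-set of vertices of $G$ induces a transitive triangle (resp. an independent set). A type is an oriented graph with vertices labeled $1,\dots,|\sigma|$; a flag over type $\sigma$ is an oriented graph with an induced embedding of $\sigma$; flags are isomorphic if there is an isomorphism preserving the labeled type vertices. The types used are: the empty type $\emptyset$; the non-edge type $\bar E$ (two labeled vertices, no edge); the edge type $E$ (two labeled vertices with the edge directed from vertex $1$ to vertex $2$). $\mathcal F_\emptyset$ is the set of all (isomorphism classes of) flags over $\emptyset$ with $2$ vertices (2 flags), $\mathcal F_{\bar E}$ the set of all $3$-vertex flags over $\bar E$ (9 flags), and $\mathcal F_E$ the set of all $3$-vertex flags over $E$ (9 flags). A $\sigma$-rooting of $G$ is a flag over $\sigma$ with underlying graph $G$. For flags $F_1,F_2\in\mathcal F$ and an oriented graph $G$, $p(F_1,F_2;G)$ is defined by choosing a uniformly random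 $\sigma$-rooting of $G$ with type image $S$ and uniformly random disjoint $L_1,L_2\subseteq V(G)\setminus S$ with $|L_j|=|F_j|-|\sigma|$; it is the probability that the flag induced on $S\cup L_j$ is isomorphic to $F_j$ for $j=1,2$ (and it is $0$ if $F_1,F_2$ have different types or the process is ill-defined). $A_G$ is the $20\times20$ matrix with entries $p(F_1,F_2;G)$, and $\langle A,B\rangle=\sum_{i,j}a_{ij}b_{ij}$. -}

module Defs where

open import Data.Bool using (Bool; true; false; T; _∧_; _∨_; not; if_then_else_)
open import Data.Nat using (ℕ; zero; suc; _<ᵇ_; _≡ᵇ_; _+_)
open import Data.Fin using (Fin; zero; suc; toℕ; _↑ˡ_; splitAt; remQuot)
open import Data.Vec using (Vec; []; _∷_; lookup; toList; _++_)
open import Data.List using (List; []; _∷_; [_]; map; concatMap; allFin; foldr)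
open import Data.Product using (_×_; _,_; Σ-syntax)
open import Data.Sum using (_⊎_; inj₁; inj₂)
open import Data.Integer using (+_)
open import Data.Rational using (ℚ; 0ℚ; _/_; _≤_) renaming (_+_ to _+ℚ_; _*_ to _*ℚ_)
open import Relation.Binary.PropositionalEquality using (_≡_)

all : ∀ {A : Set} → (A → Bool) → List A → Bool
all p []       = true
all p (x ∷ xs) = p x ∧ all p xs

any : ∀ {A : Set} → (A → Bool) → List A → Bool
any p []       = false
any p (x ∷ xs) = p x ∨ any p xs

_==_ : ∀ {n} → Fin n → Fin n → Bool
i == j = toℕ i ≡ᵇ toℕ j

allVecs : (k n : ℕ) → List (Vec (Fin n) k)
allVecs zero    n = [ [] ]
allVecs (suc k) n = concatMap (λ x → map (x ∷_) (allVecs k n)) (allFin n)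

distinctL : ∀ {n} → List (Fin n) → Bool
distinctL []       = true
distinctL (x ∷ xs) = not (any (x ==_) xs) ∧ distinctL xs

distinct : ∀ {n k} → Vec (Fin n) k → Bool
distinct v = distinctL (toList v)

-- strictly increasing entries (a k-subset listed in increasing order)
increasingL : ∀ {n} → List (Fin n) → Bool
increasingL []           = true
increasingL (x ∷ [])     = true
increasingL (x ∷ y ∷ xs) = (toℕ x <ᵇ toℕ y) ∧ increasingL (y ∷ xs)

increasing : ∀ {n k} → Vec (Fin n) k → Bool
increasing v = increasingL (toList v)

disjoint : ∀ {n k l} → Vec (Fin n) k → Vec (Fin n) l → Bool
disjoint u v = all (λ x → not (any (x ==_) (toList v))) (toList u)

countᵇ : ∀ {A : Set} → (A → Bool) → List A → ℕ
countᵇ p []       = 0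
countᵇ p (x ∷ xs) = if p x then suc (countᵇ p xs) else countᵇ p xs

lengthL : ∀ {A : Set} → List A → ℕ
lengthL []       = 0
lengthL (_ ∷ xs) = suc (lengthL xs)

-- a / b as a rational, with the convention 0 when b = 0 (ill-defined process)
ratio : ℕ → ℕ → ℚ
ratio a zero    = 0ℚ
ratio a (suc b) = (+ a) / suc b

Adj : ℕ → Set
Adj n = Fin n → Fin n → Bool

-- no loops, and no pair of vertices joined in both directions
-- (at most one arc per pair is automatic for a Boolean adjacency relation)
isOriented : ∀ {n} → Adj n → Bool
isOriented {n} a =
  all (λ i → not (a i i) ∧ all (λ j → not (a i j ∧ a j i)) (allFin n)) (allFin n)

record OGraph (n : ℕ) : Set where
  constructor ograph
  field
    adj      : Adj n
    oriented : T (isOriented adj)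
open OGraph public

-- Flags.  A flag over a type σ (an oriented graph on Fin s) with l
-- unlabeled vertices is an oriented graph on Fin (s + l) whose vertices
-- a ↑ˡ l (a : Fin s, the first s vertices) carry label a+1 and induce σ.

record Flag {s : ℕ} (σ : OGraph s) (l : ℕ) : Set where
  constructor flag
  field
    graph : OGraph (s + l)
    typed : T (all (λ a → all (λ b →
              not (adj graph (a ↑ˡ l) (b ↑ˡ l))
                ∨ adj σ a b) (allFin s)) (allFin s)
            ∧ all (λ a → all (λ b →
              not (adj σ a b) ∨ adj graph (a ↑ˡ l) (b ↑ˡ l))
                (allFin s)) (allFin s))
open Flag public

flagIso : ∀ s l → Adj (s + l) → Adj (s + l) → Bool
flagIso s l A B =
  any (λ π → distinct π
             ∧ all (λ a → lookup π (a ↑ˡ l) == (a ↑ˡ l)) (allFin s)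
             ∧ all (λ i → all (λ j → eqB (B i j) (A (lookup π i) (lookup π j)))
                 (allFin (s + l))) (allFin (s + l)))
      (allVecs (s + l) (s + l))
  where
  eqB : Bool → Bool → Bool
  eqB true  y = y
  eqB false y = not y

induced : ∀ {n k} → OGraph n → Vec (Fin n) k → Adj k
induced G v i j = adj G (lookup v i) (lookup v j)

isRooting : ∀ {n s} → OGraph n → OGraph s → Vec (Fin n) s → Bool
isRooting {n} {s} G σ θ =
  distinct θ ∧
  all (λ a → all (λ b → eqB (adj G (lookup θ a) (lookup θ b)) (adj σ a b))
    (allFin s)) (allFin s)
  where
  eqB : Bool → Bool → Bool
  eqB true  y = y
  eqB false y = not y

-- p(F₁,F₂;G): uniform random σ-rooting θ of G, then uniform random
-- disjoint L₁, L₂ ⊆ V(G) ∖ im θ with |Lⱼ| = lⱼ.  Since the number of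
-- choices of (L₁,L₂) does not depend on θ, this is the uniform
-- distribution on admissible triples (θ, L₁, L₂); subsets are listed as
-- strictly increasing vectors.  Value 0 if there is no admissible triple.
pFlags : ∀ {n s l₁ l₂} {σ : OGraph s} → Flag σ l₁ → Flag σ l₂ → OGraph n → ℚ
pFlags {n} {s} {l₁} {l₂} {σ} F₁ F₂ G =
  ratio (countᵇ good triples) (lengthL triples)
  where
  Triple = Vec (Fin n) s × Vec (Fin n) l₁ × Vec (Fin n) l₂
  triples : List Triple
  triples =
    concatMap (λ θ →
      if isRooting G σ θ then
        concatMap (λ L₁ →
          if increasing L₁ ∧ disjoint L₁ θ then
            concatMap (λ L₂ →
              if increasing L₂ ∧ disjoint L₂ θ ∧ disjoint L₂ L₁
              then [ (θ , L₁ , L₂) ] else [])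
              (allVecs l₂ n)
          else [])
          (allVecs l₁ n)
      else [])
      (allVecs s n)
  good : Triple → Bool
  good (θ , L₁ , L₂) =
    flagIso s l₁ (induced G (θ ++ L₁)) (adj (graph F₁)) ∧
    flagIso s l₂ (induced G (θ ++ L₂)) (adj (graph F₂))

ttAdj : Adj 3
ttAdj zero (suc zero)       = true
ttAdj (suc zero) (suc (suc zero)) = true
ttAdj zero (suc (suc zero)) = true
ttAdj _ _ = false

threeSets : (n : ℕ) → List (Vec (Fin n) 3)
threeSets n = go (allVecs 3 n)
  where
  go : List (Vec (Fin n) 3) → List (Vec (Fin n) 3)
  go [] = []
  go (v ∷ vs) = if increasing v then v ∷ go vs else go vs

isTT : ∀ {n} → OGraph n → Vec (Fin n) 3 → Bool
isTT G v = flagIso 0 3 (induced G v) ttAdj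

isIndep : ∀ {n} → OGraph n → Vec (Fin n) 3 → Bool
isIndep G v = all (λ i → all (λ j → not (induced G v i j)) (allFin 3)) (allFin 3)

tDens : ∀ {n} → OGraph n → ℚ
tDens {n} G = ratio (countᵇ (isTT G) (threeSets n)) (lengthL (threeSets n))

iDens : ∀ {n} → OGraph n → ℚ
iDens {n} G = ratio (countᵇ (isIndep G) (threeSets n)) (lengthL (threeSets n))

cVal : ∀ {n} → OGraph n → ℚ
cVal G = tDens G +ℚ iDens G

typeEmpty : OGraph 0
typeEmpty = ograph (λ ()) _

typeNonEdge : OGraph 2
typeNonEdge = ograph (λ _ _ → false) _

edgeAdj : Adj 2
edgeAdj zero (suc zero) = true
edgeAdj _ _ = false

typeEdge : OGraph 2
typeEdge = ograph edgeAdj _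

flagsEmpty : Fin 2 → Flag typeEmpty 2
flagsEmpty zero       = flag (ograph (λ _ _ → false) _) _
flagsEmpty (suc zero) = flag (ograph edgeAdj _) _

-- relation of the unlabeled vertex 2 to a labeled vertex a
data Rel : Set where
  none to from : Rel   -- none; arc 2 → a; arc a → 2

isTo isFrom : Rel → Bool
isTo to = true
isTo _  = false
isFrom from = true
isFrom _    = false

rel3 : Fin 3 → Rel
rel3 zero             = none
rel3 (suc zero)       = to
rel3 (suc (suc zero)) = from

-- 3-vertex graph: e = arc 0 → 1 present?, r₁ / r₂ = relation of vertex 2 to 0 / 1
mk3 : Bool → Rel → Rel → Adj 3
mk3 e r₁ r₂ zero (suc zero) = e
mk3 e r₁ r₂ (suc (suc zero)) zero = isTo r₁
mk3 e r₁ r₂ zero (suc (suc zero)) = isFrom r₁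
mk3 e r₁ r₂ (suc (suc zero)) (suc zero) = isTo r₂
mk3 e r₁ r₂ (suc zero) (suc (suc zero)) = isFrom r₂
mk3 e r₁ r₂ _ _ = false

mk3-or : ∀ e r₁ r₂ → T (isOriented (mk3 e r₁ r₂))
mk3-or true  none none = _
mk3-or true  none to   = _
mk3-or true  none from = _
mk3-or true  to   none = _
mk3-or true  to   to   = _
mk3-or true  to   from = _
mk3-or true  from none = _
mk3-or true  from to   = _
mk3-or true  from from = _
mk3-or false none none = _
mk3-or false none to   = _
mk3-or false none from = _
mk3-or false to   none = _
mk3-or false to   to   = _
mk3-or false to   from = _
mk3-or false from none = _
mk3-or false from to   = _
mk3-or false from from = _

flagsNonEdge : Fin 9 → Flag typeNonEdge 1
flagsNonEdge k with remQuot {3} 3 k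
... | (x , y) = flag (ograph (mk3 false (rel3 x) (rel3 y)) (mk3-or false (rel3 x) (rel3 y))) (ty (rel3 x) (rel3 y))
  where
  ty : ∀ r₁ r₂ → _
  ty none none = _
  ty none to   = _
  ty none from = _
  ty to   none = _
  ty to   to   = _
  ty to   from = _
  ty from none = _
  ty from to   = _
  ty from from = _

flagsEdge : Fin 9 → Flag typeEdge 1
flagsEdge k with remQuot {3} 3 k
... | (x , y) = flag (ograph (mk3 true (rel3 x) (rel3 y)) (mk3-or true (rel3 x) (rel3 y))) (ty (rel3 x) (rel3 y))
  where
  ty : ∀ r₁ r₂ → _
  ty none none = _
  ty none to   = _
  ty none from = _
  ty to   none = _
  ty to   to   = _
  ty to   from = _
  ty from none = _
  ty from to   = _
  ty from from = _

FlagIx : Set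
FlagIx = Fin 2 ⊎ Fin 9 ⊎ Fin 9

decode : Fin 20 → FlagIx
decode k with splitAt 2 k
... | inj₁ a = inj₁ a
... | inj₂ b with splitAt 9 b
...   | inj₁ c = inj₂ (inj₁ c)
...   | inj₂ d = inj₂ (inj₂ d)

Matrix20 : Set
Matrix20 = Fin 20 → Fin 20 → ℚ

pIx : ∀ {n} → FlagIx → FlagIx → OGraph n → ℚ
pIx (inj₁ a) (inj₁ b) G = pFlags (flagsEmpty a) (flagsEmpty b) G
pIx (inj₂ (inj₁ a)) (inj₂ (inj₁ b)) G = pFlags (flagsNonEdge a) (flagsNonEdge b) G
pIx (inj₂ (inj₂ a)) (inj₂ (inj₂ b)) G = pFlags (flagsEdge a) (flagsEdge b) G
pIx _ _ G = 0ℚ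

A : ∀ {n} → OGraph n → Matrix20
A G i j = pIx (decode i) (decode j) G

sumFin : ∀ {m} → (Fin m → ℚ) → ℚ
sumFin {m} f = foldr (λ i acc → f i +ℚ acc) 0ℚ (allFin m)

⟨_,_⟩ : Matrix20 → Matrix20 → ℚ
⟨ P , R ⟩ = sumFin (λ i → sumFin (λ j → P i j *ℚ R i j))

PSD : Matrix20 → Set
PSD Q = (∀ i j → Q i j ≡ Q j i)
      × (∀ (x : Fin 20 → ℚ) → 0ℚ ≤ sumFin (λ i → sumFin (λ j → x i *ℚ Q i j *ℚ x j)))

{-# OPTIONS --safe #-}
module Submission where

open import Defs
open import Data.Product using (Σ-syntax; _×_)
open import Data.Integer using (+_)
open import Data.Rational using (ℚ; _≤_; _+_; _/_)

open import Data.Bool using (Bool; true; false; T; _∧_; _∨_; not; if_then_else_)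
open import Data.Bool.Properties using (T-∧; T-≡) renaming (_≟_ to _≟ᵇ_)
open import Data.Fin using (Fin; zero; suc; combine; #_)
open import Data.Fin.Properties using (all?; toℕ-injective)
open import Data.Integer as ℤ using (ℤ; -_)
import Data.Integer.Properties as ℤ
open import Data.Integer.Solver using () renaming (module +-*-Solver to ℤ-Solver)
open import Data.List using (List; []; _∷_; _++_; allFin; concatMap; foldr; map)
open import Data.List.Membership.Propositional using (_∈_)
open import Data.List.Membership.Propositional.Properties using (∈-allFin)
open import Data.List.Properties using (concatMap-cong; map-tabulate)
open import Data.List.Relation.Unary.All as All using (All; []; _∷_)
import Data.List.Relation.Unary.All.Properties as All
open import Data.List.Relation.Unary.Any using (here; there)
open import Data.Nat using (ℕ; zero; suc)
open import Data.Nat.Properties using (≡ᵇ⇒≡)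
open import Data.Product using (_,_; proj₁; proj₂)
open import Data.Rational using (0ℚ; 1ℚ; _*_; _≤?_; toℚᵘ; nonNegative; nonPositive)
open import Data.Rational.Literals using (fromℤ)
open import Data.Rational.Properties
  using ( toℚᵘ-injective; toℚᵘ-fromℚᵘ; toℚᵘ-homo-+; toℚᵘ-homo-*; +-identityˡ; +-identityʳ; +-assoc; +-mono-≤
        ; *-identityˡ; *-identityʳ; *-zeroˡ; *-zeroʳ; *-assoc; *-comm; *-distribˡ-+; *-distribʳ-+
        ; ≤-refl; ≤-total; nonNegative⁻¹; nonNeg*nonNeg⇒nonNeg; nonPos*nonPos⇒nonPos)
open import Data.Rational.Solver using (module +-*-Solver)
open import Data.Rational.Unnormalised as ℚᵘ using (mkℚᵘ; *≡*)
import Data.Rational.Unnormalised.Properties as ℚᵘ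
open import Data.Sum using (inj₁; inj₂)
open import Data.Unit using (tt)
open import Data.Vec using (Vec; []; _∷_; lookup) renaming (_++_ to _++ᵛ_)
open import Function using (_∘_; id; Equivalence)
open import Relation.Binary.PropositionalEquality
  using (_≡_; _≗_; refl; sym; trans; cong; cong₂; subst; subst₂; module ≡-Reasoning)
import Relation.Binary.Reasoning.Setoid
open import Relation.Nullary.Decidable using (toWitness)

-- Take Q block-diagonal with zero ∅-block, written as 1/225 times a sum of w v vᵀ with w ≥ 0 and integral v,
-- so that it is visibly positive semidefinite.  A 3-vertex flag over a 2-vertex type is determined by the
-- relations of its unlabeled vertex to the two roots, so ⟨Q, A_G⟩ is, for each type, the average of
-- Q(flag of x, flag of y) over the rootings (a, b) and the two orders x, y of the remaining vertices.
-- Both sides of the inequality are then cheap functions of the six pairwise relations of G, and it is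
-- checked for all 3⁶ of them.  Since the densities are normalised by the number of rootings of G itself,
-- the optimum of this program is about 0.12, which leaves the slack that makes such small integers possible.

-- Finite sums and double sums

-- Over `allFin m` this unfolds to the same fold as `sumFin`, so facts about it apply to `PSD` and
-- `⟨_,_⟩` by computation.
∑ : ∀ {X : Set} → List X → (X → ℚ) → ℚ
∑ xs f = foldr (λ x acc → f x + acc) 0ℚ xs

∑-cong : ∀ {X : Set} (xs : List X) {f g : X → ℚ} → f ≗ g → ∑ xs f ≡ ∑ xs g
∑-cong []       f≗g = refl
∑-cong (x ∷ xs) f≗g = cong₂ _+_ (f≗g x) (∑-cong xs f≗g)

∑-zero : ∀ {X : Set} (xs : List X) {f : X → ℚ} → (∀ x → f x ≡ 0ℚ) → ∑ xs f ≡ 0ℚ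
∑-zero []       f≗0 = refl
∑-zero (x ∷ xs) f≗0 = cong₂ _+_ (f≗0 x) (∑-zero xs f≗0)

∑-+ : ∀ {X : Set} (xs : List X) (f g : X → ℚ) → ∑ xs (λ x → f x + g x) ≡ ∑ xs f + ∑ xs g
∑-+ []       f g = refl
∑-+ (x ∷ xs) f g = trans (cong (λ y → (f x + g x) + y) (∑-+ xs f g))
  (solve 4 (λ a b c d → (a :+ b) :+ (c :+ d) := (a :+ c) :+ (b :+ d)) refl (f x) (g x) (∑ xs f) (∑ xs g))
  where open +-*-Solver

∑-*ˡ : ∀ {X : Set} (xs : List X) c (f : X → ℚ) → ∑ xs (λ x → c * f x) ≡ c * ∑ xs f
∑-*ˡ []       c f = sym (*-zeroʳ c)
∑-*ˡ (x ∷ xs) c f = trans (cong (λ y → c * f x + y) (∑-*ˡ xs c f)) (sym (*-distribˡ-+ c (f x) (∑ xs f)))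

∑-*ʳ : ∀ {X : Set} (xs : List X) (f : X → ℚ) c → ∑ xs (λ x → f x * c) ≡ ∑ xs f * c
∑-*ʳ []       f c = sym (*-zeroˡ c)
∑-*ʳ (x ∷ xs) f c = trans (cong (λ y → f x * c + y) (∑-*ʳ xs f c)) (sym (*-distribʳ-+ c (f x) (∑ xs f)))

∑-++ : ∀ {X : Set} (xs ys : List X) (f : X → ℚ) → ∑ (xs ++ ys) f ≡ ∑ xs f + ∑ ys f
∑-++ []       ys f = sym (+-identityˡ (∑ ys f))
∑-++ (x ∷ xs) ys f = trans (cong (λ y → f x + y) (∑-++ xs ys f)) (sym (+-assoc (f x) (∑ xs f) (∑ ys f)))

∑-map : ∀ {X Y : Set} (h : X → Y) xs (f : Y → ℚ) → ∑ (map h xs) f ≡ ∑ xs (f ∘ h)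
∑-map h []       f = refl
∑-map h (x ∷ xs) f = cong (λ y → f (h x) + y) (∑-map h xs f)

∑-nonNeg : ∀ {X : Set} (xs : List X) {f : X → ℚ} → (∀ x → 0ℚ ≤ f x) → 0ℚ ≤ ∑ xs f
∑-nonNeg []       0≤f = ≤-refl
∑-nonNeg (x ∷ xs) 0≤f = +-mono-≤ (0≤f x) (∑-nonNeg xs 0≤f)

∑∑ : ∀ {X : Set} → List X → (X → X → ℚ) → ℚ
∑∑ xs f = ∑ xs (λ i → ∑ xs (f i))

∑∑-cong : ∀ {X : Set} (xs : List X) {f g : X → X → ℚ} → (∀ i j → f i j ≡ g i j) → ∑∑ xs f ≡ ∑∑ xs g
∑∑-cong xs f≗g = ∑-cong xs (λ i → ∑-cong xs (f≗g i))

∑∑-zero : ∀ {X : Set} (xs : List X) {f : X → X → ℚ} → (∀ i j → f i j ≡ 0ℚ) → ∑∑ xs f ≡ 0ℚ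
∑∑-zero xs f≗0 = ∑-zero xs (λ i → ∑-zero xs (f≗0 i))

∑∑-+ : ∀ {X : Set} (xs : List X) (f g : X → X → ℚ) → ∑∑ xs (λ i j → f i j + g i j) ≡ ∑∑ xs f + ∑∑ xs g
∑∑-+ xs f g = trans (∑-cong xs (λ i → ∑-+ xs (f i) (g i))) (∑-+ xs (λ i → ∑ xs (f i)) (λ i → ∑ xs (g i)))

∑∑-*ˡ : ∀ {X : Set} (xs : List X) c (f : X → X → ℚ) → ∑∑ xs (λ i j → c * f i j) ≡ c * ∑∑ xs f
∑∑-*ˡ xs c f = trans (∑-cong xs (λ i → ∑-*ˡ xs c (f i))) (∑-*ˡ xs c (λ i → ∑ xs (f i)))

∑∑-product : ∀ {X : Set} (xs : List X) (f g : X → ℚ) → ∑∑ xs (λ i j → f i * g j) ≡ ∑ xs f * ∑ xs g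
∑∑-product xs f g = trans (∑-cong xs (λ i → ∑-*ˡ xs (f i) g)) (∑-*ʳ xs f (∑ xs g))

δ : Bool → ℚ
δ b = if b then 1ℚ else 0ℚ

δ-∧ : ∀ p q → δ (p ∧ q) ≡ δ p * δ q
δ-∧ true  q = sym (*-identityˡ (δ q))
δ-∧ false q = sym (*-zeroˡ (δ q))

∑-allFin-suc : ∀ {m} (f : Fin (suc m) → ℚ) → ∑ (allFin (suc m)) f ≡ f zero + ∑ (allFin m) (f ∘ suc)
∑-allFin-suc {m} f = cong (λ y → f zero + y) (trans (cong (λ xs → ∑ xs f) (sym (map-tabulate id suc))) (∑-map suc (allFin m) f))

-- Induction on `k`: the test `suc k == suc i` reduces to `k == i`, so splitting off the first
-- summand leaves the same sum for `f ∘ suc`.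
∑-δ : ∀ {m} (k : Fin m) (f : Fin m → ℚ) → ∑ (allFin m) (λ i → f i * δ (k == i)) ≡ f k
∑-δ {suc m} zero f = begin
  ∑ (allFin (suc m)) (λ i → f i * δ (zero == i))  ≡⟨ ∑-allFin-suc (λ i → f i * δ (zero == i)) ⟩
  f zero * 1ℚ + ∑ (allFin m) (λ i → f (suc i) * 0ℚ)
    ≡⟨ cong₂ _+_ (*-identityʳ (f zero)) (∑-zero (allFin m) (λ i → *-zeroʳ (f (suc i)))) ⟩
  f zero + 0ℚ ≡⟨ +-identityʳ (f zero) ⟩
  f zero ∎
  where open ≡-Reasoning
∑-δ {suc m} (suc k) f = begin
  ∑ (allFin (suc m)) (λ i → f i * δ (suc k == i))  ≡⟨ ∑-allFin-suc (λ i → f i * δ (suc k == i)) ⟩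
  f zero * 0ℚ + ∑ (allFin m) (λ i → f (suc i) * δ (k == i)) ≡⟨ cong₂ _+_ (*-zeroʳ (f zero)) (∑-δ k (f ∘ suc)) ⟩
  0ℚ + f (suc k) ≡⟨ +-identityˡ (f (suc k)) ⟩
  f (suc k) ∎
  where open ≡-Reasoning

-- Integers and ratios inside the rationals

-- Among unnormalised rationals no common factors are cancelled, and the claim becomes a polynomial
-- identity over the integers.
fromℤ-+ : ∀ a b → fromℤ (a ℤ.+ b) ≡ fromℤ a + fromℤ b
fromℤ-+ a b = toℚᵘ-injective (ℚᵘ.≃-trans
  (*≡* (solve 2 (λ a b → (a :+ b) :* (con (+ 1) :* con (+ 1)) := (a :* con (+ 1) :+ b :* con (+ 1)) :* con (+ 1)) refl a b))
  (ℚᵘ.≃-sym (toℚᵘ-homo-+ (fromℤ a) (fromℤ b))))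
  where open ℤ-Solver

fromℤ-* : ∀ a b → fromℤ (a ℤ.* b) ≡ fromℤ a * fromℤ b
fromℤ-* a b = toℚᵘ-injective (ℚᵘ.≃-trans
  (*≡* (solve 2 (λ a b → (a :* b) :* (con (+ 1) :* con (+ 1)) := (a :* b) :* con (+ 1)) refl a b))
  (ℚᵘ.≃-sym (toℚᵘ-homo-* (fromℤ a) (fromℤ b))))
  where open ℤ-Solver

-- Separates the integer count from the normalisation, which can then be pulled out of sums. For
-- `n = 0` both sides vanish by the convention in `ratio`.
ratio-fromℤ : ∀ a n → ratio a n ≡ fromℤ (+ a) * ratio 1 n
ratio-fromℤ a zero    = sym (*-zeroʳ (fromℤ (+ a)))
ratio-fromℤ a (suc n) = toℚᵘ-injective (begin
  toℚᵘ (+ a / suc n)   ≈⟨ toℚᵘ-fromℚᵘ (mkℚᵘ (+ a) n) ⟩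
  mkℚᵘ (+ a) n  ≈⟨ *≡* (solve 2 (λ a n → a :* (con (+ 1) :* n) := (a :* con (+ 1)) :* n) refl (+ a) (+ suc n)) ⟩
  toℚᵘ (fromℤ (+ a)) ℚᵘ.* mkℚᵘ (+ 1) n  ≈⟨ ℚᵘ.*-congˡ {toℚᵘ (fromℤ (+ a))} (toℚᵘ-fromℚᵘ (mkℚᵘ (+ 1) n)) ⟨
  toℚᵘ (fromℤ (+ a)) ℚᵘ.* toℚᵘ (+ 1 / suc n) ≈⟨ toℚᵘ-homo-* (fromℤ (+ a)) (+ 1 / suc n) ⟨
  toℚᵘ (fromℤ (+ a) * (+ 1 / suc n)) ∎)
  where
  open ℤ-Solver using (solve; _:*_; _:=_; con)
  open Relation.Binary.Reasoning.Setoid ℚᵘ.≃-setoid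

square-nonNeg : ∀ p → 0ℚ ≤ p * p
square-nonNeg p with ≤-total 0ℚ p
... | inj₁ 0≤p = nonNegative⁻¹ (p * p) {{nonNeg*nonNeg⇒nonNeg p {{nonNegative 0≤p}} p {{nonNegative 0≤p}}}}
... | inj₂ p≤0 = nonNegative⁻¹ (p * p) {{nonPos*nonPos⇒nonPos p {{nonPositive p≤0}} p {{nonPositive p≤0}}}}

-- Double counting of triples by flag pairs

sumℤ : ∀ {X : Set} → (X → ℤ) → List X → ℤ
sumℤ f = foldr (λ x acc → f x ℤ.+ acc) (+ 0)

-- Each `t` in the list is counted for exactly one index pair, `(f t , g t)`. Exchanging the two
-- summations therefore leaves a single value of `q` per `t`.
∑-count : ∀ {X : Set} {m} (f g : X → Fin m) (good : Fin m → Fin m → X → Bool) (q : Fin m → Fin m → ℤ) (ts : List X) →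
  All (λ t → ∀ i j → good i j t ≡ (f t == i) ∧ (g t == j)) ts →
  ∑∑ (allFin m) (λ i j → fromℤ (q i j) * fromℤ (+ countᵇ (good i j) ts)) ≡ fromℤ (sumℤ (λ t → q (f t) (g t)) ts)
∑-count {m = m} f g good q [] [] = ∑∑-zero (allFin m) (λ i j → *-zeroʳ (fromℤ (q i j)))
∑-count {m = m} f g good q (t ∷ ts) (e ∷ es) = begin
  ∑∑ is (λ i j → fromℤ (q i j) * fromℤ (+ countᵇ (good i j) (t ∷ ts)))
    ≡⟨ ∑∑-cong is split ⟩
  ∑∑ is (λ i j → hit i j + rest i j)
    ≡⟨ ∑∑-+ is hit rest ⟩
  ∑∑ is hit + ∑∑ is rest
    ≡⟨ cong₂ _+_ pick (∑-count f g good q ts es) ⟩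
  fromℤ (q (f t) (g t)) + fromℤ (sumℤ (λ t → q (f t) (g t)) ts)
    ≡⟨ fromℤ-+ (q (f t) (g t)) (sumℤ (λ t → q (f t) (g t)) ts) ⟨
  fromℤ (q (f t) (g t) ℤ.+ sumℤ (λ t → q (f t) (g t)) ts) ∎
  where
  open ≡-Reasoning
  is : List (Fin m)
  is = allFin m
  c : Fin m → Fin m → ℚ
  c i j = fromℤ (+ countᵇ (good i j) ts)
  hit rest : Fin m → Fin m → ℚ
  -- The contribution of `t` itself, with the factors ordered so that `∑-δ` collapses first the
  -- inner sum over `j` and then the outer one over `i`.
  hit i j = (fromℤ (q i j) * δ (g t == j)) * δ (f t == i)
  rest i j = fromℤ (q i j) * c i j
  count-∷ : ∀ i j → fromℤ (+ countᵇ (good i j) (t ∷ ts)) ≡ δ (good i j t) + c i j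
  count-∷ i j with good i j t
  ... | true  = fromℤ-+ (+ 1) (+ countᵇ (good i j) ts)
  ... | false = sym (+-identityˡ (c i j))
  split : ∀ i j → fromℤ (q i j) * fromℤ (+ countᵇ (good i j) (t ∷ ts))
                ≡ hit i j + rest i j
  split i j = trans
    (cong (fromℤ (q i j) *_) (trans (count-∷ i j) (cong (_+ c i j) (trans (cong δ (e i j)) (δ-∧ (f t == i) (g t == j))))))
    (solve 4 (λ x a b y → x :* (a :* b :+ y) := x :* b :* a :+ x :* y) refl (fromℤ (q i j)) (δ (f t == i)) (δ (g t == j)) (c i j))
    where open +-*-Solver
  pick : ∑∑ is hit ≡ fromℤ (q (f t) (g t))
  pick = trans
    (∑-cong is (λ i → trans (∑-*ʳ is (λ j → fromℤ (q i j) * δ (g t == j)) (δ (f t == i)))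
      (cong (_* δ (f t == i)) (∑-δ (g t) (λ j → fromℤ (q i j))))))
    (∑-δ (f t) (λ i → fromℤ (q i (g t))))

-- Weighted Gram matrices

gram : ∀ {X : Set} → List (ℕ × (X → ℤ)) → X → X → ℤ
gram ws i j = sumℤ (λ (w , v) → + w ℤ.* (v i ℤ.* v j)) ws

gram-sym : ∀ {X : Set} (ws : List (ℕ × (X → ℤ))) i j → gram ws i j ≡ gram ws j i
gram-sym []             i j = refl
gram-sym ((w , v) ∷ ws) i j = cong₂ (λ a b → + w ℤ.* a ℤ.+ b) (ℤ.*-comm (v i) (v j)) (gram-sym ws i j)

-- Each rank-one summand w v vᵀ contributes w times the square of the linear form of `v` at `x`.
-- With `c` nonnegative, semidefiniteness can be read off the right-hand side.
gram-squares : ∀ {X Y : Set} (is : List Y) (h : Y → X) (ws : List (ℕ × (X → ℤ))) (c : ℚ) (x : Y → ℚ) →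
  ∑∑ is (λ i j → x i * (fromℤ (gram ws (h i) (h j)) * c) * x j)
  ≡ ∑ ws (λ (w , v) → (fromℤ (+ w) * c) * (∑ is (λ i → x i * fromℤ (v (h i))) * ∑ is (λ i → x i * fromℤ (v (h i)))))
gram-squares is h [] c x = ∑∑-zero is (λ i j →
  solve 3 (λ a c b → a :* (con 0ℚ :* c) :* b := con 0ℚ) refl (x i) c (x j))
  where open +-*-Solver
gram-squares is h ((w , v) ∷ ws) c x = begin
  ∑∑ is (λ i j → x i * (fromℤ (gram ((w , v) ∷ ws) (h i) (h j)) * c) * x j)
    ≡⟨ ∑∑-cong is split ⟩
  ∑∑ is (λ i j → (W * c) * (l i * l j) + rest i j)
    ≡⟨ ∑∑-+ is (λ i j → (W * c) * (l i * l j)) rest ⟩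
  ∑∑ is (λ i j → (W * c) * (l i * l j)) + ∑∑ is rest
    ≡⟨ cong₂ _+_ (trans (∑∑-*ˡ is (W * c) (λ i j → l i * l j)) (cong (W * c *_) (∑∑-product is l l)))
         (gram-squares is h ws c x) ⟩
  (W * c) * (∑ is l * ∑ is l) +
  ∑ ws (λ (w , v) → (fromℤ (+ w) * c) * (∑ is (λ i → x i * fromℤ (v (h i))) * ∑ is (λ i → x i * fromℤ (v (h i))))) ∎
  where
  open ≡-Reasoning
  W : ℚ
  W = fromℤ (+ w)
  l : _ → ℚ
  l i = x i * fromℤ (v (h i))
  rest : _ → _ → ℚ
  rest i j = x i * (fromℤ (gram ws (h i) (h j)) * c) * x j
  split : ∀ i j → x i * (fromℤ (gram ((w , v) ∷ ws) (h i) (h j)) * c) * x j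
                ≡ (W * c) * (l i * l j) + rest i j
  split i j = trans
    (cong (λ y → x i * (y * c) * x j)
      (trans (fromℤ-+ (+ w ℤ.* (v (h i) ℤ.* v (h j))) (gram ws (h i) (h j)))
        (cong (_+ fromℤ (gram ws (h i) (h j)))
          (trans (fromℤ-* (+ w) (v (h i) ℤ.* v (h j))) (cong (W *_) (fromℤ-* (v (h i)) (v (h j))))))))
    (solve 7 (λ a w p q g c b →
        a :* ((w :* (p :* q) :+ g) :* c) :* b := (w :* c) :* ((a :* p) :* (b :* q)) :+ a :* (g :* c) :* b)
      refl (x i) W (fromℤ (v (h i))) (fromℤ (v (h j))) (fromℤ (gram ws (h i) (h j))) c (x j))
    where open +-*-Solver

-- Boolean quantifiers and congruence of the isomorphism test

all-cong : ∀ {X : Set} {p q : X → Bool} → p ≗ q → all p ≗ all q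
all-cong p≗q []       = refl
all-cong p≗q (x ∷ xs) = cong₂ _∧_ (p≗q x) (all-cong p≗q xs)

all-sound : ∀ {X : Set} (p : X → Bool) {x} xs → T (all p xs) → x ∈ xs → T (p x)
all-sound p (y ∷ ys) pass (here refl) = proj₁ (Equivalence.to T-∧ pass)
all-sound p (y ∷ ys) pass (there x∈ys) = all-sound p ys (proj₂ (Equivalence.to T-∧ pass)) x∈ys

-- The Boolean equality inside flagIso is local to Defs, so congruence is obtained by unfolding at fixed sizes.
flagIso-cong₂₁ : {A A′ : Adj 3} (B : Adj 3) → (∀ i j → A i j ≡ A′ i j) → flagIso 2 1 A B ≡ flagIso 2 1 A′ B
flagIso-cong₂₁ {A} {A′} B A≗A′
  rewrite A≗A′ (# 0) (# 0) | A≗A′ (# 0) (# 1) | A≗A′ (# 0) (# 2)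
        | A≗A′ (# 1) (# 0) | A≗A′ (# 1) (# 1) | A≗A′ (# 1) (# 2)
        | A≗A′ (# 2) (# 0) | A≗A′ (# 2) (# 1) | A≗A′ (# 2) (# 2) = refl

flagIso-cong₀₃ : {A A′ : Adj 3} (B : Adj 3) → (∀ i j → A i j ≡ A′ i j) → flagIso 0 3 A B ≡ flagIso 0 3 A′ B
flagIso-cong₀₃ {A} {A′} B A≗A′
  rewrite A≗A′ (# 0) (# 0) | A≗A′ (# 0) (# 1) | A≗A′ (# 0) (# 2)
        | A≗A′ (# 1) (# 0) | A≗A′ (# 1) (# 1) | A≗A′ (# 1) (# 2)
        | A≗A′ (# 2) (# 0) | A≗A′ (# 2) (# 1) | A≗A′ (# 2) (# 2) = refl

-- Pairwise relations and three-vertex flags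

flip : Fin 3 → Fin 3
flip zero             = zero
flip (suc zero)       = suc (suc zero)
flip (suc (suc zero)) = suc zero

out : Fin 3 → Bool
out (suc zero) = true
out _          = false

-- The relation of i to j: 0 for no arc, 1 for i → j, 2 for j → i.  The relation of the unlabeled vertex to a
-- root is then the index used by rel3.
code : Bool → Bool → Fin 3
code true  _     = # 1
code false true  = # 2
code false false = # 0

out-code : ∀ p q → out (code p q) ≡ p
out-code true  _     = refl
out-code false true  = refl
out-code false false = refl

flip-code : ∀ p q → T (not (p ∧ q)) → code q p ≡ flip (code p q)
flip-code true  false _ = refl
flip-code false true  _ = refl
flip-code false false _ = refl

rel : ∀ {n} → Adj n → Fin n → Fin n → Fin 3
rel A i j = code (A i j) (A j i)

noLoop : ∀ {n} (G : OGraph n) i → T (not (adj G i i))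
noLoop {n} G i = proj₁ (Equivalence.to T-∧ (all-sound _ (allFin n) (oriented G) (∈-allFin i)))

noTwoCycle : ∀ {n} (G : OGraph n) i j → T (not (adj G i j ∧ adj G j i))
noTwoCycle {n} G i j =
  all-sound _ (allFin n) (proj₂ (Equivalence.to T-∧ (all-sound _ (allFin n) (oriented G) (∈-allFin i)))) (∈-allFin j)

-- The relation table of an oriented graph on 0, 1, 2 whose pairs 01, 02, 12 have relations `r`,
-- `s`, `t`.
skew₃ : Fin 3 → Fin 3 → Fin 3 → Fin 3 → Fin 3 → Fin 3
skew₃ r s t i j = lookup (lookup
  ( (zero   ∷ r      ∷ s    ∷ [])
  ∷ (flip r ∷ zero   ∷ t    ∷ [])
  ∷ (flip s ∷ flip t ∷ zero ∷ []) ∷ []) i) j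

-- An isomorphism fixing both roots also fixes the third vertex, so only identical flags match; the
-- 81 cases are evaluated. `s` and `t` are read from the unlabeled vertex to the roots, whence
-- `flip`, and `combine` inverts the `remQuot` that numbers the flags.
classify-nonEdge : ∀ s t k → flagIso 2 1 (λ i j → out (skew₃ zero (flip s) (flip t) i j)) (adj (graph (flagsNonEdge k))) ≡ combine s t == k
classify-nonEdge = toWitness {a? = all? λ s → all? λ t → all? λ k → _ ≟ᵇ _} tt


classify-edge : ∀ s t k → flagIso 2 1 (λ i j → out (skew₃ (# 1) (flip s) (flip t) i j)) (adj (graph (flagsEdge k))) ≡ combine s t == k
classify-edge = toWitness {a? = all? λ s → all? λ t → all? λ k → _ ≟ᵇ _} tt

rel-diag : ∀ {n} (G : OGraph n) i → rel (adj G) i i ≡ # 0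
rel-diag G i with adj G i i | noLoop G i
... | false | _ = refl

rel-flip : ∀ {n} (G : OGraph n) i j → rel (adj G) j i ≡ flip (rel (adj G) i j)
rel-flip G i j = flip-code (adj G i j) (adj G j i) (noTwoCycle G i j)

adj-out-rel : ∀ {n} (A : Adj n) i j → A i j ≡ out (rel A i j)
adj-out-rel A i j = sym (out-code (A i j) (A j i))

-- Rootings and induced subgraphs of a four-vertex graph

Relations : Set
Relations = Fin 4 → Fin 4 → Fin 3

rooted : Fin 3 → Relations → Vec (Fin 4) 2 → Bool
rooted r ρ θ@(a ∷ b ∷ []) = distinct θ ∧ (ρ a b == r)

-- `noLoop` and `noTwoCycle` leave three possibilities for the adjacency bits on the two roots, and
-- in each of them both sides compute to the same term.
isRooting-nonEdge : ∀ (G : OGraph 4) θ → isRooting G typeNonEdge θ ≡ rooted (# 0) (rel (adj G)) θ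
isRooting-nonEdge G (a ∷ b ∷ [])
  with adj G a a | noLoop G a | adj G b b | noLoop G b | adj G a b | adj G b a | noTwoCycle G a b
... | false | _ | false | _ | false | false | _ = refl
... | false | _ | false | _ | false | true  | _ = refl
... | false | _ | false | _ | true  | false | _ = refl

isRooting-edge : ∀ (G : OGraph 4) θ → isRooting G typeEdge θ ≡ rooted (# 1) (rel (adj G)) θ
isRooting-edge G (a ∷ b ∷ [])
  with adj G a a | noLoop G a | adj G b b | noLoop G b | adj G a b | adj G b a | noTwoCycle G a b
... | false | _ | false | _ | false | false | _ = refl
... | false | _ | false | _ | false | true  | _ = refl
... | false | _ | false | _ | true  | false | _ = refl

-- Orientedness makes the diagonal empty and the lower triangle the reversal of the upper one, so
-- three relations determine the induced subgraph.
induced-skew₃ : ∀ (G : OGraph 4) a b x i j → let ρ = rel (adj G) in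
  induced G (a ∷ b ∷ x ∷ []) i j ≡ out (skew₃ (ρ a b) (ρ a x) (ρ b x) i j)
induced-skew₃ G a b x i j = trans (adj-out-rel (adj G) (v i) (v j)) (cong out (skew i j))
  where
  ρ : Relations
  ρ = rel (adj G)
  v : Fin 3 → Fin 4
  v = lookup (a ∷ b ∷ x ∷ [])
  skew : ∀ i j → ρ (v i) (v j) ≡ skew₃ (ρ a b) (ρ a x) (ρ b x) i j
  skew zero             zero             = rel-diag G a
  skew zero             (suc zero)       = refl
  skew zero             (suc (suc zero)) = refl
  skew (suc zero)       zero             = rel-flip G a b
  skew (suc zero)       (suc zero)       = rel-diag G b
  skew (suc zero)       (suc (suc zero)) = refl
  skew (suc (suc zero)) zero             = rel-flip G a x
  skew (suc (suc zero)) (suc zero)       = rel-flip G b x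
  skew (suc (suc zero)) (suc (suc zero)) = rel-diag G x

-- Admissible triples of a two-vertex type

Triple : Set
Triple = Vec (Fin 4) 2 × Vec (Fin 4) 1 × Vec (Fin 4) 1

-- Listed in the order of allVecs 2 4, so that the triples of pFlags are recovered by computation.
arrangements : List (Fin 4 × Fin 4 × Fin 4 × Fin 4)
arrangements =
    (# 0 , # 1 , # 2 , # 3) ∷ (# 0 , # 2 , # 1 , # 3) ∷ (# 0 , # 3 , # 1 , # 2)
  ∷ (# 1 , # 0 , # 2 , # 3) ∷ (# 1 , # 2 , # 0 , # 3) ∷ (# 1 , # 3 , # 0 , # 2)
  ∷ (# 2 , # 0 , # 1 , # 3) ∷ (# 2 , # 1 , # 0 , # 3) ∷ (# 2 , # 3 , # 0 , # 1)
  ∷ (# 3 , # 0 , # 1 , # 2) ∷ (# 3 , # 1 , # 0 , # 2) ∷ (# 3 , # 2 , # 0 , # 1) ∷ []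

triplesAt : (Vec (Fin 4) 2 → Bool) → Fin 4 × Fin 4 × Fin 4 × Fin 4 → List Triple
triplesAt p (a , b , x , y) =
  if p θ then (θ , x ∷ [] , y ∷ []) ∷ (θ , y ∷ [] , x ∷ []) ∷ [] else []
  where
  θ : Vec (Fin 4) 2
  θ = a ∷ b ∷ []

triples : (Vec (Fin 4) 2 → Bool) → List Triple
triples p = concatMap (triplesAt p) arrangements

triples-cong : ∀ {p q} → p ≗ q → triples p ≡ triples q
triples-cong p≗q = concatMap-cong (λ (a , b , x , y) →
  cong (λ c → if c then (a ∷ b ∷ [] , x ∷ [] , y ∷ []) ∷ (a ∷ b ∷ [] , y ∷ [] , x ∷ []) ∷ [] else [])
    (p≗q (a ∷ b ∷ []))) arrangements

triples-All : ∀ (p : Vec (Fin 4) 2 → Bool) (P : Triple → Set) →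
  (∀ θ L₁ L₂ → p θ ≡ true → P (θ , L₁ , L₂)) → All P (triples p)
triples-All p P rootedP = All.concat⁺ (All.map⁺ (All.universal at arrangements))
  where
  at : ∀ r → All P (triplesAt p r)
  at (a , b , x , y) with p (a ∷ b ∷ []) in eq
  ... | true  = rootedP _ _ _ eq ∷ rootedP _ _ _ eq ∷ []
  ... | false = []

good : ∀ {σ : OGraph 2} → Flag σ 1 → Flag σ 1 → OGraph 4 → Triple → Bool
good F₁ F₂ G (θ , L₁ , L₂) =
  flagIso 2 1 (induced G (θ ++ᵛ L₁)) (adj (graph F₁)) ∧
  flagIso 2 1 (induced G (θ ++ᵛ L₂)) (adj (graph F₂))

-- On four vertices the tests `increasing` and `disjoint` evaluate completely, and root pairs with a
-- repeated vertex drop out through `distinct`. Only `isRooting` on distinct roots stays symbolic,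
-- identically on both sides.
pFlags-triples : ∀ {σ : OGraph 2} (F₁ F₂ : Flag σ 1) (G : OGraph 4) →
  pFlags F₁ F₂ G ≡ ratio (countᵇ (good F₁ F₂ G) (triples (isRooting G σ))) (lengthL (triples (isRooting G σ)))
pFlags-triples F₁ F₂ G = refl

-- The contribution of one type

flagClass : Relations → Vec (Fin 4) 2 → Vec (Fin 4) 1 → Fin 9
flagClass ρ (a ∷ b ∷ []) (x ∷ []) = combine (ρ x a) (ρ x b)

blockSum : Fin 3 → (Fin 9 → Fin 9 → ℤ) → Relations → ℤ
blockSum r q ρ = sumℤ (λ (θ , L₁ , L₂) → q (flagClass ρ θ L₁) (flagClass ρ θ L₂)) (triples (rooted r ρ))

-- ratio 1 0 = 0 covers graphs without rootings.
blockValue : Fin 3 → (Fin 9 → Fin 9 → ℤ) → Relations → ℚ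
blockValue r q ρ = fromℤ (blockSum r q ρ) * ratio 1 (lengthL (triples (rooted r ρ)))

==⇒≡ : ∀ {n} {i j : Fin n} → (i == j) ≡ true → i ≡ j
==⇒≡ {i = i} {j} eq = toℕ-injective (≡ᵇ⇒≡ _ _ (Equivalence.from T-≡ eq))

module Block {σ : OGraph 2} (F : Fin 9 → Flag σ 1) (r : Fin 3)
  (isRooting-σ : ∀ (G : OGraph 4) θ → isRooting G σ θ ≡ rooted r (rel (adj G)) θ)
  (classify : ∀ s t k → flagIso 2 1 (λ i j → out (skew₃ r (flip s) (flip t) i j)) (adj (graph (F k))) ≡ combine s t == k)
  where

  -- Being rooted forces the relation between the roots to be `r`, which brings the induced table
  -- into the form covered by `classify`.
  flagIso-flagClass : ∀ (G : OGraph 4) θ L k → rooted r (rel (adj G)) θ ≡ true →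
    flagIso 2 1 (induced G (θ ++ᵛ L)) (adj (graph (F k))) ≡ flagClass (rel (adj G)) θ L == k
  flagIso-flagClass G (a ∷ b ∷ []) (x ∷ []) k root = trans
    (flagIso-cong₂₁ (adj (graph (F k))) (λ i j → trans (induced-skew₃ G a b x i j) (roots i j)))
    (classify (ρ x a) (ρ x b) k)
    where
    ρ : Relations
    ρ = rel (adj G)
    ρab≡r : ρ a b ≡ r
    ρab≡r = ==⇒≡ (Equivalence.to T-≡ (proj₂ (Equivalence.to T-∧ (Equivalence.from T-≡ root))))
    roots : ∀ i j → out (skew₃ (ρ a b) (ρ a x) (ρ b x) i j) ≡ out (skew₃ r (flip (ρ x a)) (flip (ρ x b)) i j)
    roots i j rewrite ρab≡r | rel-flip G x a | rel-flip G x b = refl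

  -- The number of triples depends on `G` and the type but not on the flag pair, so its inverse `ν`
  -- factors out and `∑-count` evaluates the rest.
  pFlags-sum : ∀ (q : Fin 9 → Fin 9 → ℤ) (G : OGraph 4) →
    ∑∑ (allFin 9) (λ i j → fromℤ (q i j) * pFlags (F i) (F j) G) ≡ blockValue r q (rel (adj G))
  pFlags-sum q G = begin
    ∑∑ (allFin 9) (λ i j → fromℤ (q i j) * pFlags (F i) (F j) G)
      ≡⟨ ∑∑-cong (allFin 9) (λ i j → entry i j) ⟩
    ∑∑ (allFin 9) (λ i j → ν * (fromℤ (q i j) * fromℤ (+ countᵇ (good (F i) (F j) G) ts)))
      ≡⟨ ∑∑-*ˡ (allFin 9) ν (λ i j → fromℤ (q i j) * fromℤ (+ countᵇ (good (F i) (F j) G) ts)) ⟩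
    ν * ∑∑ (allFin 9) (λ i j → fromℤ (q i j) * fromℤ (+ countᵇ (good (F i) (F j) G) ts))
      ≡⟨ cong (ν *_) (∑-count _ _ (λ i j → good (F i) (F j) G) q ts (triples-All _ _ (λ θ L₁ L₂ root i j →
           cong₂ _∧_ (flagIso-flagClass G θ L₁ i root) (flagIso-flagClass G θ L₂ j root)))) ⟩
    ν * fromℤ (blockSum r q ρ)
      ≡⟨ *-comm ν (fromℤ (blockSum r q ρ)) ⟩
    blockValue r q ρ ∎
    where
    open ≡-Reasoning
    ρ : Relations
    ρ = rel (adj G)
    ts : List Triple
    ts = triples (rooted r ρ)
    ν : ℚ
    ν = ratio 1 (lengthL ts)
    entry : ∀ i j → fromℤ (q i j) * pFlags (F i) (F j) G ≡ ν * (fromℤ (q i j) * fromℤ (+ countᵇ (good (F i) (F j) G) ts))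
    entry i j = begin
      fromℤ (q i j) * pFlags (F i) (F j) G ≡⟨ cong (fromℤ (q i j) *_) (pFlags-triples (F i) (F j) G) ⟩
      fromℤ (q i j) * ratio (countᵇ (good (F i) (F j) G) (triples (isRooting G σ))) (lengthL (triples (isRooting G σ)))
        ≡⟨ cong (λ ts → fromℤ (q i j) * ratio (countᵇ (good (F i) (F j) G) ts) (lengthL ts)) (triples-cong (isRooting-σ G)) ⟩
      fromℤ (q i j) * ratio c (lengthL ts) ≡⟨ cong (fromℤ (q i j) *_) (ratio-fromℤ c (lengthL ts)) ⟩
      fromℤ (q i j) * (fromℤ (+ c) * ν) ≡⟨ *-assoc (fromℤ (q i j)) (fromℤ (+ c)) ν ⟨
      fromℤ (q i j) * fromℤ (+ c) * ν ≡⟨ *-comm (fromℤ (q i j) * fromℤ (+ c)) ν ⟩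
      ν * (fromℤ (q i j) * fromℤ (+ c)) ∎
      where
      c : ℕ
      c = countᵇ (good (F i) (F j) G) ts

open Block flagsNonEdge (# 0) isRooting-nonEdge classify-nonEdge using () renaming (pFlags-sum to pFlags-sum-nonEdge)
open Block flagsEdge (# 1) isRooting-edge classify-edge using () renaming (pFlags-sum to pFlags-sum-edge)

-- The certificate matrix

-- Extension by zero keeps each v vᵀ inside the diagonal block of its type.
onNonEdge onEdge : Vec ℤ 9 → FlagIx → ℤ
onNonEdge v (inj₂ (inj₁ k)) = lookup v k
onNonEdge v _               = + 0
onEdge v (inj₂ (inj₂ k)) = lookup v k
onEdge v _               = + 0

-- Entry 3 s + t belongs to the flag whose unlabeled vertex has relation s to the first and t to the second root.
-- The vectors are rounded from a numerical solution that is symmetric under arc reversal (and, for the non-edge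
-- type, under swapping the roots).
certificate : List (ℕ × (FlagIx → ℤ))
certificate =
    ( 2 , onNonEdge (+ 10 ∷ + 1 ∷ +   1 ∷ +   1 ∷ - + 3 ∷ - + 2 ∷ +   1 ∷ - + 2 ∷ - + 3 ∷ []))
  ∷ (46 , onNonEdge (+ 0  ∷ + 1 ∷ - + 1 ∷ +   1 ∷ +   1 ∷ +   0 ∷ - + 1 ∷ +   0 ∷ - + 1 ∷ []))
  ∷ (36 , onNonEdge (+ 0  ∷ + 1 ∷ +   1 ∷ - + 1 ∷ +   0 ∷ +   0 ∷ - + 1 ∷ +   0 ∷ +   0 ∷ []))
  ∷ ( 1 , onEdge    (+ 3  ∷ + 1 ∷ +   0 ∷ +   0 ∷ - + 8 ∷ - + 6 ∷ +   1 ∷ - + 7 ∷ - + 8 ∷ []))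
  ∷ (34 , onEdge    (+ 0  ∷ + 1 ∷ +   1 ∷ - + 1 ∷ +   0 ∷ +   0 ∷ - + 1 ∷ +   0 ∷ +   0 ∷ []))
  ∷ (56 , onEdge    (+ 0  ∷ + 1 ∷ +   0 ∷ +   0 ∷ +   0 ∷ +   0 ∷ - + 1 ∷ +   0 ∷ +   0 ∷ []))
  ∷ []

κ : ℚ
κ = + 1 / 225

weight : FlagIx → FlagIx → ℚ
weight i j = fromℤ (gram certificate i j) * κ

Q : Matrix20
Q i j = weight (decode i) (decode j)

Q-PSD : PSD Q
Q-PSD = (λ i j → cong (λ z → fromℤ z * κ) (gram-sym certificate (decode i) (decode j))) ,
  λ x → subst (0ℚ ≤_) (sym (gram-squares (allFin 20) decode certificate κ x))
    (∑-nonNeg certificate (λ (w , v) →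
      0≤* (0≤* (nonNegative⁻¹ (fromℤ (+ w))) (nonNegative⁻¹ κ))
          (square-nonNeg (∑ (allFin 20) (λ i → x i * fromℤ (v (decode i)))))))
  where
  0≤* : ∀ {p q} → 0ℚ ≤ p → 0ℚ ≤ q → 0ℚ ≤ p * q
  0≤* {p} {q} 0≤p 0≤q = nonNegative⁻¹ (p * q) {{nonNeg*nonNeg⇒nonNeg p {{nonNegative 0≤p}} q {{nonNegative 0≤q}}}}

gramᴺ gramᴱ : Fin 9 → Fin 9 → ℤ
gramᴺ i j = gram certificate (inj₂ (inj₁ i)) (inj₂ (inj₁ j))
gramᴱ i j = gram certificate (inj₂ (inj₂ i)) (inj₂ (inj₂ j))

-- Block decomposition of the inner product

∑-decode : ∀ (f : FlagIx → ℚ) → ∑ (allFin 20) (f ∘ decode) ≡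
  ∑ (allFin 2) (f ∘ inj₁) + (∑ (allFin 9) (f ∘ inj₂ ∘ inj₁) + ∑ (allFin 9) (f ∘ inj₂ ∘ inj₂))
∑-decode f = begin
  ∑ (allFin 20) (f ∘ decode)  ≡⟨ ∑-map decode (allFin 20) f ⟨
  -- `decode` runs on closed indices, so this list and the concatenation evaluate to the same twenty
  -- entries.
  ∑ (map decode (allFin 20)) f  ≡⟨⟩
  ∑ (os ++ (ns ++ es)) f
    ≡⟨ trans (∑-++ os (ns ++ es) f) (cong (λ y → ∑ os f + y) (∑-++ ns es f)) ⟩
  ∑ os f + (∑ ns f + ∑ es f)
    ≡⟨ cong₂ _+_ (∑-map inj₁ (allFin 2) f)
         (cong₂ _+_ (∑-map (inj₂ ∘ inj₁) (allFin 9) f) (∑-map (inj₂ ∘ inj₂) (allFin 9) f)) ⟩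
  _ ∎
  where
  open ≡-Reasoning
  os ns es : List FlagIx
  os = map inj₁ (allFin 2)
  ns = map (inj₂ ∘ inj₁) (allFin 9)
  es = map (inj₂ ∘ inj₂) (allFin 9)

∑∑-decode : ∀ (f : FlagIx → FlagIx → ℚ) →
  (∀ i j → f (inj₁ i) j ≡ 0ℚ) → (∀ i j → f (inj₂ i) (inj₁ j) ≡ 0ℚ) →
  (∀ i j → f (inj₂ (inj₁ i)) (inj₂ (inj₂ j)) ≡ 0ℚ) → (∀ i j → f (inj₂ (inj₂ i)) (inj₂ (inj₁ j)) ≡ 0ℚ) →
  ∑∑ (allFin 20) (λ i j → f (decode i) (decode j)) ≡
  ∑∑ (allFin 9) (λ i j → f (inj₂ (inj₁ i)) (inj₂ (inj₁ j))) + ∑∑ (allFin 9) (λ i j → f (inj₂ (inj₂ i)) (inj₂ (inj₂ j)))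
∑∑-decode f e₁ e₂ ne en = begin
  ∑∑ (allFin 20) (λ i j → f (decode i) (decode j))
    ≡⟨ ∑-decode (λ i → ∑ (allFin 20) (λ j → f i (decode j))) ⟩
  ∑ (allFin 2) (row ∘ inj₁) + (∑ (allFin 9) (row ∘ inj₂ ∘ inj₁) + ∑ (allFin 9) (row ∘ inj₂ ∘ inj₂))
    ≡⟨ cong₂ _+_ (∑-zero (allFin 2) (λ i → ∑-zero (allFin 20) (λ j → e₁ i (decode j))))
         (cong₂ _+_ (∑-cong (allFin 9) rowᴺ) (∑-cong (allFin 9) rowᴱ)) ⟩
  0ℚ + (blockᴺ + blockᴱ)
    ≡⟨ +-identityˡ (blockᴺ + blockᴱ) ⟩
  blockᴺ + blockᴱ ∎
  where
  open ≡-Reasoning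
  row : FlagIx → ℚ
  row i = ∑ (allFin 20) (λ j → f i (decode j))
  blockᴺ blockᴱ : ℚ
  blockᴺ = ∑∑ (allFin 9) (λ i j → f (inj₂ (inj₁ i)) (inj₂ (inj₁ j)))
  blockᴱ = ∑∑ (allFin 9) (λ i j → f (inj₂ (inj₂ i)) (inj₂ (inj₂ j)))
  rowᴺ : ∀ i → row (inj₂ (inj₁ i)) ≡ ∑ (allFin 9) (λ j → f (inj₂ (inj₁ i)) (inj₂ (inj₁ j)))
  rowᴺ i = trans (∑-decode (f (inj₂ (inj₁ i))))
    (trans (cong₂ _+_ (∑-zero (allFin 2) (e₂ (inj₁ i))) (cong (λ y → s + y) (∑-zero (allFin 9) (ne i))))
      (trans (+-identityˡ (s + 0ℚ)) (+-identityʳ s)))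
    where
    s : ℚ
    s = ∑ (allFin 9) (λ j → f (inj₂ (inj₁ i)) (inj₂ (inj₁ j)))
  rowᴱ : ∀ i → row (inj₂ (inj₂ i)) ≡ ∑ (allFin 9) (λ j → f (inj₂ (inj₂ i)) (inj₂ (inj₂ j)))
  rowᴱ i = trans (∑-decode (f (inj₂ (inj₂ i))))
    (trans (cong₂ _+_ (∑-zero (allFin 2) (e₂ (inj₂ i))) (cong (λ y → y + s) (∑-zero (allFin 9) (en i))))
      (trans (+-identityˡ (0ℚ + s)) (+-identityˡ s)))
    where
    s : ℚ
    s = ∑ (allFin 9) (λ j → f (inj₂ (inj₂ i)) (inj₂ (inj₂ j)))

-- The rows of the empty type vanish because all certificate vectors are zero there; the other mixed
-- entries vanish because `pIx` is `0ℚ` on flags of different types.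
⟨Q,A⟩-blocks : ∀ (G : OGraph 4) → let ρ = rel (adj G) in
  ⟨ Q , A G ⟩ ≡ κ * blockValue (# 0) gramᴺ ρ + κ * blockValue (# 1) gramᴱ ρ
⟨Q,A⟩-blocks G = trans
  (∑∑-decode (λ i j → weight i j * pIx i j G)
    (λ { i (inj₁ j) → weightᴼ (pIx (inj₁ i) (inj₁ j) G) ; i (inj₂ j) → weightᴼ (pIx (inj₁ i) (inj₂ j) G) })
    (λ { (inj₁ i) j → *-zeroʳ (weight (inj₂ (inj₁ i)) (inj₁ j)) ; (inj₂ i) j → *-zeroʳ (weight (inj₂ (inj₂ i)) (inj₁ j)) })
    (λ i j → *-zeroʳ (weight (inj₂ (inj₁ i)) (inj₂ (inj₂ j))))
    (λ i j → *-zeroʳ (weight (inj₂ (inj₂ i)) (inj₂ (inj₁ j)))))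
  (cong₂ _+_
    (block gramᴺ (λ i j → pFlags (flagsNonEdge i) (flagsNonEdge j) G) (pFlags-sum-nonEdge gramᴺ G))
    (block gramᴱ (λ i j → pFlags (flagsEdge i) (flagsEdge j) G) (pFlags-sum-edge gramᴱ G)))
  where
  weightᴼ : ∀ p → 0ℚ * p ≡ 0ℚ
  weightᴼ = *-zeroˡ
  block : ∀ q (p : Fin 9 → Fin 9 → ℚ) {s : ℚ} → ∑∑ (allFin 9) (λ i j → fromℤ (q i j) * p i j) ≡ s →
    ∑∑ (allFin 9) (λ i j → (fromℤ (q i j) * κ) * p i j) ≡ κ * s
  block q p eq = trans
    (∑∑-cong (allFin 9) (λ i j → trans (cong (_* p i j) (*-comm (fromℤ (q i j)) κ)) (*-assoc κ (fromℤ (q i j)) (p i j))))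
    (trans (∑∑-*ˡ (allFin 9) κ (λ i j → fromℤ (q i j) * p i j)) (cong (κ *_) eq))

-- The objective in terms of relations

countᵇ-cong : ∀ {X : Set} {p q : X → Bool} → p ≗ q → countᵇ p ≗ countᵇ q
countᵇ-cong p≗q []       = refl
countᵇ-cong {p = p} {q} p≗q (x ∷ xs) rewrite p≗q x | countᵇ-cong p≗q xs = refl

-- In a tournament on a, b, c, the relations r = ab, s = ac, t = bc are cyclic iff r = t ≠ s.
transitive independent : Fin 3 → Fin 3 → Fin 3 → Bool
transitive (suc r) (suc s) (suc t) = not (r == t) ∨ (r == s)
transitive _       _       _       = false
independent zero zero zero = true
independent _    _    _    = false

onTriple : (Fin 3 → Fin 3 → Fin 3 → Bool) → Relations → Vec (Fin 4) 3 → Bool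
onTriple p ρ (a ∷ b ∷ c ∷ []) = p (ρ a b) (ρ a c) (ρ b c)

isTT-transitive : ∀ (G : OGraph 4) v → isTT G v ≡ onTriple transitive (rel (adj G)) v
isTT-transitive G (a ∷ b ∷ c ∷ []) = trans
  (flagIso-cong₀₃ ttAdj (induced-skew₃ G a b c))
  (table (rel (adj G) a b) (rel (adj G) a c) (rel (adj G) b c))
  where
  table : ∀ r s t → flagIso 0 3 (λ i j → out (skew₃ r s t i j)) ttAdj ≡ transitive r s t
  table = toWitness {a? = all? λ r → all? λ s → all? λ t → _ ≟ᵇ _} tt

isIndep-independent : ∀ (G : OGraph 4) v → isIndep G v ≡ onTriple independent (rel (adj G)) v
isIndep-independent G (a ∷ b ∷ c ∷ []) = trans
  (all-cong (λ i → all-cong (λ j → cong not (induced-skew₃ G a b c i j)) (allFin 3)) (allFin 3))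
  (table (rel (adj G) a b) (rel (adj G) a c) (rel (adj G) b c))
  where
  table : ∀ r s t → all (λ i → all (λ j → not (out (skew₃ r s t i j))) (allFin 3)) (allFin 3) ≡ independent r s t
  table = toWitness {a? = all? λ r → all? λ s → all? λ t → _ ≟ᵇ _} tt

-- The denominator 4 is the number of 3-subsets of a 4-set.
value : Relations → ℚ
value ρ = ratio (countᵇ (onTriple transitive ρ) (threeSets 4)) 4 + ratio (countᵇ (onTriple independent ρ) (threeSets 4)) 4

cVal-value : ∀ (G : OGraph 4) → cVal G ≡ value (rel (adj G))
cVal-value G = cong₂ (λ a b → ratio a 4 + ratio b 4)
  (countᵇ-cong (isTT-transitive G) (threeSets 4)) (countᵇ-cong (isIndep-independent G) (threeSets 4))

-- Reduction to a finite check

bound : Relations → ℚ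
bound ρ = (κ * blockValue (# 0) gramᴺ ρ + κ * blockValue (# 1) gramᴱ ρ) + (+ 1 / 9)

sumℤ-cong : ∀ {X : Set} {f g : X → ℤ} → f ≗ g → sumℤ f ≗ sumℤ g
sumℤ-cong f≗g []       = refl
sumℤ-cong f≗g (x ∷ xs) = cong₂ ℤ._+_ (f≗g x) (sumℤ-cong f≗g xs)

module _ {ρ ρ′ : Relations} (ρ≗ρ′ : ∀ i j → ρ i j ≡ ρ′ i j) where

  flagClass-cong : ∀ θ L → flagClass ρ θ L ≡ flagClass ρ′ θ L
  flagClass-cong (a ∷ b ∷ []) (x ∷ []) = cong₂ combine (ρ≗ρ′ x a) (ρ≗ρ′ x b)

  rooted-cong : ∀ r → rooted r ρ ≗ rooted r ρ′
  rooted-cong r (a ∷ b ∷ []) = cong (λ s → distinct (a ∷ b ∷ []) ∧ (s == r)) (ρ≗ρ′ a b)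

  blockValue-cong : ∀ r q → blockValue r q ρ ≡ blockValue r q ρ′
  blockValue-cong r q = cong₂ (λ s ts → fromℤ s * ratio 1 (lengthL ts))
    (trans
      (sumℤ-cong (λ (θ , L₁ , L₂) → cong₂ q (flagClass-cong θ L₁) (flagClass-cong θ L₂)) (triples (rooted r ρ)))
      (cong (sumℤ (λ (θ , L₁ , L₂) → q (flagClass ρ′ θ L₁) (flagClass ρ′ θ L₂))) (triples-cong (rooted-cong r))))
    (triples-cong (rooted-cong r))

  -- A graph's relations agree with their table `skew₄` pointwise, so moving the inequality from
  -- tables to graphs uses this congruence together with `value-cong`.
  bound-cong : bound ρ ≡ bound ρ′
  bound-cong = cong₂ (λ a b → (κ * a + κ * b) + (+ 1 / 9)) (blockValue-cong (# 0) gramᴺ) (blockValue-cong (# 1) gramᴱ)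

  onTriple-cong : ∀ p → onTriple p ρ ≗ onTriple p ρ′
  onTriple-cong p (a ∷ b ∷ c ∷ []) rewrite ρ≗ρ′ a b | ρ≗ρ′ a c | ρ≗ρ′ b c = refl

  value-cong : value ρ ≡ value ρ′
  value-cong = cong₂ (λ a b → ratio a 4 + ratio b 4)
    (countᵇ-cong (onTriple-cong transitive) (threeSets 4)) (countᵇ-cong (onTriple-cong independent) (threeSets 4))

-- The arguments are the relations of the pairs 01, 02, 03, 12, 13, 23.
skew₄ : Fin 3 → Fin 3 → Fin 3 → Fin 3 → Fin 3 → Fin 3 → Relations
skew₄ r s t u v w i j = lookup (lookup
  ( (zero   ∷ r      ∷ s      ∷ t    ∷ [])
  ∷ (flip r ∷ zero   ∷ u      ∷ v    ∷ [])
  ∷ (flip s ∷ flip u ∷ zero   ∷ w    ∷ [])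
  ∷ (flip t ∷ flip v ∷ flip w ∷ zero ∷ []) ∷ []) i) j

rel-skew₄ : ∀ (G : OGraph 4) i j → let ρ = rel (adj G) in
  ρ i j ≡ skew₄ (ρ (# 0) (# 1)) (ρ (# 0) (# 2)) (ρ (# 0) (# 3)) (ρ (# 1) (# 2)) (ρ (# 1) (# 3)) (ρ (# 2) (# 3)) i j
rel-skew₄ G = λ where
  zero                   zero                   → rel-diag G _
  zero                   (suc zero)             → refl
  zero                   (suc (suc zero))       → refl
  zero                   (suc (suc (suc zero))) → refl
  (suc zero)             zero                   → rel-flip G _ _
  (suc zero)             (suc zero)             → rel-diag G _
  (suc zero)             (suc (suc zero))       → refl
  (suc zero)             (suc (suc (suc zero))) → refl
  (suc (suc zero))       zero                   → rel-flip G _ _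
  (suc (suc zero))       (suc zero)             → rel-flip G _ _
  (suc (suc zero))       (suc (suc zero))       → rel-diag G _
  (suc (suc zero))       (suc (suc (suc zero))) → refl
  (suc (suc (suc zero))) zero                   → rel-flip G _ _
  (suc (suc (suc zero))) (suc zero)             → rel-flip G _ _
  (suc (suc (suc zero))) (suc (suc zero))       → rel-flip G _ _
  (suc (suc (suc zero))) (suc (suc (suc zero))) → rel-diag G _

-- The 729 tables are exactly the labeled oriented graphs on four vertices, so every one of the 42
-- isomorphism classes occurs among these closed rational comparisons.
bound≤value-skew₄ : ∀ r s t u v w → bound (skew₄ r s t u v w) ≤ value (skew₄ r s t u v w)
bound≤value-skew₄ = toWitness
  {a? = all? λ r → all? λ s → all? λ t → all? λ u → all? λ v → all? λ w →
    bound (skew₄ r s t u v w) ≤? value (skew₄ r s t u v w)} tt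

bound≤value : ∀ (G : OGraph 4) → bound (rel (adj G)) ≤ value (rel (adj G))
bound≤value G = subst₂ _≤_ (sym (bound-cong (rel-skew₄ G))) (sym (value-cong (rel-skew₄ G)))
  (bound≤value-skew₄ (ρ (# 0) (# 1)) (ρ (# 0) (# 2)) (ρ (# 0) (# 3)) (ρ (# 1) (# 2)) (ρ (# 1) (# 3)) (ρ (# 2) (# 3)))
  where
  ρ : Relations
  ρ = rel (adj G)

theorem5p1 : Σ[ Q ∈ Matrix20 ] (PSD Q × (∀ (G : OGraph 4) → ⟨ Q , A G ⟩ + (+ 1 / 9) ≤ cVal G))
theorem5p1 = Q , Q-PSD , λ G →
  subst₂ _≤_ (cong (λ y → y + (+ 1 / 9)) (sym (⟨Q,A⟩-blocks G))) (sym (cVal-value G)) (bound≤value G)
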